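{- Let $k$ be a positive integer and let $E_k(x)=\sum_{n=0}^{\infty}b_{k,n}\frac{x^n}{n!}$ be the exponential generating function of the binomial transform $\{b_{k,n}\}_{n\ge0}$ of the higher order Mersenne numbers. Then $$E_k(x)=\frac{e^{m_kx}-e^{2x}}{2^k-1} .$$
   Context: The Mersenne numbers $\{M_n\}_{n\ge 0}$ are defined by $M_0=0$, $M_1=1$, $M_{n+2}=3M_{n+1}-2M_n$, i.e. $M_n=2^n-1$. The Mersenne-Lucas numbers satisfy the same recurrence with $m_0=2$, $m_1=3$, i.e. $m_n=2^n+1$. For a positive integer $k$, the higher order Mersenne numbers are $M_n^{(k)}=M_{kn}/M_k$ for $n=0,1,2,\dots$, and their binomial transform is $b_{k,n}=\sum_{i=0}^{n}\binom{n}{i}M_i^{(k)}$ for $n\ge 0$. -}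

module Defs where

open import Data.Fin.Base using (toℕ)
open import Data.Integer.Base as ℤ using (ℤ; +_)
open import Data.Integer.GCD using (gcd)
import Data.Integer.Properties as ℤ
open import Data.Integer.Tactic.RingSolver using (solve-∀)
open import Data.Nat.Base as ℕ using (ℕ; zero; suc; _!)
import Data.Nat.Properties as ℕ
open import Data.Nat.Combinatorics using (_C_)
open import Data.Rational.Base
  using (ℚ; 1ℚ; NonZero; ≢-nonZero; ↥_; _/_; _*_; _-_; _÷_; +-*-rawSemiring)
open import Data.Rational.Properties using (↥-/)
open import Algebra.Definitions.RawSemiring +-*-rawSemiring using (_×_; sum; _^_)
open import Relation.Binary.PropositionalEquality
  using (_≡_; _≢_; refl; sym; trans; cong; cong₂; subst)

ι : ℤ → ℚ
ι i = i / 1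

ι-nonZero : ∀ i → .{{ℤ.NonZero i}} → NonZero (ι i)
ι-nonZero i = ≢-nonZero {ι i} λ ι≡0 → ℕ.≢-nonZero⁻¹ ℤ.∣ i ∣
  (cong ℤ.∣_∣ (trans (sym (↥-/ i 1)) (cong (λ q → ↥ q ℤ.* gcd i (+ 1)) ι≡0)))

M : ℕ → ℤ
M 0             = + 0
M 1             = + 1
M (suc (suc n)) = + 3 ℤ.* M (suc n) ℤ.- + 2 ℤ.* M n

m : ℕ → ℤ
m 0             = + 2
m 1             = + 3
m (suc (suc n)) = + 3 ℤ.* m (suc n) ℤ.- + 2 ℤ.* m n

M≡2^n-1 : ∀ n → M n ≡ (+ 2) ℤ.^ n ℤ.- + 1
M≡2^n-1 0             = refl
M≡2^n-1 1             = refl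
M≡2^n-1 (suc (suc n)) = trans
  (cong₂ (λ a b → + 3 ℤ.* a ℤ.- + 2 ℤ.* b) (M≡2^n-1 (suc n)) (M≡2^n-1 n))
  (lemma ((+ 2) ℤ.^ n))
  where
  lemma : ∀ a → + 3 ℤ.* (+ 2 ℤ.* a ℤ.- + 1) ℤ.- + 2 ℤ.* (a ℤ.- + 1)
              ≡ + 2 ℤ.* (+ 2 ℤ.* a) ℤ.- + 1
  lemma = solve-∀

2^k-1-nonZero : ∀ k → .{{ℕ.NonZero k}} → ℤ.NonZero ((+ 2) ℤ.^ k ℤ.- + 1)
2^k-1-nonZero (suc k) = ℤ.≢-nonZero λ eq →
  odd ((+ 2) ℤ.^ k) (ℤ.i-j≡0⇒i≡j ((+ 2) ℤ.^ suc k) (+ 1) eq)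
  where
  even≢1 : ∀ n → 2 ℕ.* n ≢ 1
  even≢1 zero    ()
  even≢1 (suc n) eq with trans (sym (ℕ.*-suc 2 n)) eq
  ... | ()

  odd : ∀ i → + 2 ℤ.* i ≢ + 1
  odd i eq = even≢1 ℤ.∣ i ∣ (trans (sym (ℤ.abs-* (+ 2) i)) (cong ℤ.∣_∣ eq))

M-nonZero : ∀ k → .{{ℕ.NonZero k}} → ℤ.NonZero (M k)
M-nonZero k = subst ℤ.NonZero (sym (M≡2^n-1 k)) (2^k-1-nonZero k)

ιM-nonZero : ∀ k → .{{ℕ.NonZero k}} → NonZero (ι (M k))
ιM-nonZero k = ι-nonZero (M k) {{M-nonZero k}}

ι[2^k-1]-nonZero : ∀ k → .{{ℕ.NonZero k}} → NonZero (ι ((+ 2) ℤ.^ k ℤ.- + 1))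
ι[2^k-1]-nonZero k = ι-nonZero ((+ 2) ℤ.^ k ℤ.- + 1) {{2^k-1-nonZero k}}

-- M⁽ k ⁾ n is the quotient M_{kn} / M_k, taken in ℚ.
M⁽_⁾ : (k : ℕ) → .{{ℕ.NonZero k}} → ℕ → ℚ
M⁽ k ⁾ n = (ι (M (k ℕ.* n)) ÷ ι (M k)) {{ιM-nonZero k}}

-- The index i ranges over Fin (suc n), i.e. 0 ≤ i ≤ n; _×_ is the
-- natural-number multiple of a rational.
binomialTransform : (ℕ → ℚ) → (ℕ → ℚ)
binomialTransform a n = sum {suc n} λ i → (n C toℕ i) × a (toℕ i)

b : (k : ℕ) → .{{ℕ.NonZero k}} → ℕ → ℚ
b k = binomialTransform M⁽ k ⁾

-- Formal power series over ℚ: F n is the coefficient of xⁿ.  Equality of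
-- series is pointwise equality of coefficients.
PowerSeries : Set
PowerSeries = ℕ → ℚ

infixl 6 _⊖_
_⊖_ : PowerSeries → PowerSeries → PowerSeries
(F ⊖ G) n = F n - G n

infixl 7 _⊘_
_⊘_ : PowerSeries → (c : ℚ) → .{{NonZero c}} → PowerSeries
(F ⊘ c) n = F n ÷ c

-- The substitution F(x) ↦ F(cx).
rescale : ℚ → PowerSeries → PowerSeries
rescale c F n = c ^ n * F n

-- The series Σ aₙ xⁿ / n!.
egf : (ℕ → ℚ) → PowerSeries
egf a n = a n * (+ 1 / n !) {{n ℕ.!≢0}}

exp : PowerSeries
exp = egf λ _ → 1ℚ

e^[_x] : ℚ → PowerSeries
e^[ c x] = rescale c exp

E : (k : ℕ) → .{{ℕ.NonZero k}} → PowerSeries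
E k = egf (b k)

{-# OPTIONS --safe #-}

-- With c = 1 / M_k and A = 2^k, M_i^{(k)} = (Aⁱ − 1ⁱ) c.  The binomial transform is linear and, by
-- the binomial theorem, sends i ↦ aⁱ to n ↦ (a + 1)ⁿ, so b_{k,n} = ((A + 1)ⁿ − 2ⁿ) c with A + 1 = m_k.

module Submission where

open import Defs
open import Data.Nat.Base using (ℕ; NonZero)
open import Data.Integer.Base using (+_; _-_; _^_)
open import Relation.Binary.PropositionalEquality using (_≗_)

open import Algebra.Bundles using (CommutativeRing)
open import Data.Fin.Base using (Fin; toℕ)
import Data.Integer.Base as ℤ
import Data.Integer.Properties as ℤ
import Data.Integer.Tactic.RingSolver as ℤ
open import Data.Nat.Base as ℕ using (zero; suc)
open import Data.Nat.Combinatorics using (_C_)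
open import Data.Rational.Base as ℚ using (ℚ; 1ℚ; 1/_; +-*-rawSemiring)
import Data.Rational.Properties as ℚ
open import Data.Rational.Solver using (module +-*-Solver)
import Data.Rational.Unnormalised.Base as ℚᵘ
import Data.Rational.Unnormalised.Properties as ℚᵘ
open import Relation.Binary.PropositionalEquality
  using (_≡_; refl; sym; trans; cong; cong₂; module ≡-Reasoning)

open import Algebra.Definitions.RawSemiring +-*-rawSemiring using (_×_) renaming (_^_ to _^ℚ_)
open CommutativeRing ℚ.+-*-commutativeRing
  using (semiring; commutativeSemiring; +-commutativeMonoid)
open import Algebra.Properties.Semiring.Sum semiring
  using (∑-distrib-+; *-distribʳ-sum; sum-cong-≗)
open import Algebra.Properties.Semiring.Mult semiring using (×-congʳ; ×-assoc-*)
open import Algebra.Properties.CommutativeMonoid.Mult +-commutativeMonoid using (×-distrib-+)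
import Algebra.Properties.CommutativeSemiring.Binomial commutativeSemiring as Binomial

open ≡-Reasoning

-- `ι` normalises its fraction, so the identity is checked on the unnormalised fractions over 1,
-- where it reduces to one between integer numerators.
ι-homo-+ : ∀ i j → ι (i ℤ.+ j) ≡ ι i ℚ.+ ι j
ι-homo-+ i j = ℚ.toℚᵘ-injective (begin-equality
  ℚ.toℚᵘ (ι (i ℤ.+ j))            ≃⟨ ℚ.toℚᵘ-fromℚᵘ (ℚᵘ.mkℚᵘ (i ℤ.+ j) 0) ⟩
  ℚᵘ.mkℚᵘ (i ℤ.+ j) 0             ≃⟨ ℚᵘ.*≡* (cong (ℤ._* + 1) (sym (cong₂ ℤ._+_ (ℤ.*-identityʳ i) (ℤ.*-identityʳ j)))) ⟩
  ℚᵘ.mkℚᵘ i 0 ℚᵘ.+ ℚᵘ.mkℚᵘ j 0    ≃⟨ ℚᵘ.+-cong (ℚ.toℚᵘ-fromℚᵘ (ℚᵘ.mkℚᵘ i 0)) (ℚ.toℚᵘ-fromℚᵘ (ℚᵘ.mkℚᵘ j 0)) ⟨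
  ℚ.toℚᵘ (ι i) ℚᵘ.+ ℚ.toℚᵘ (ι j)  ≃⟨ ℚ.toℚᵘ-homo-+ (ι i) (ι j) ⟨
  ℚ.toℚᵘ (ι i ℚ.+ ι j)            ∎′)
  where open ℚᵘ.≤-Reasoning renaming (_∎ to _∎′)

ι-homo-* : ∀ i j → ι (i ℤ.* j) ≡ ι i ℚ.* ι j
ι-homo-* i j = ℚ.toℚᵘ-injective (begin-equality
  ℚ.toℚᵘ (ι (i ℤ.* j))            ≃⟨ ℚ.toℚᵘ-fromℚᵘ (ℚᵘ.mkℚᵘ (i ℤ.* j) 0) ⟩
  -- Unlike the sum, the unnormalised product computes to `mkℚᵘ (i * j) 0`, so its numerator needs
  -- no rewriting.
  ℚᵘ.mkℚᵘ i 0 ℚᵘ.* ℚᵘ.mkℚᵘ j 0    ≃⟨ ℚᵘ.*-cong (ℚ.toℚᵘ-fromℚᵘ (ℚᵘ.mkℚᵘ i 0)) (ℚ.toℚᵘ-fromℚᵘ (ℚᵘ.mkℚᵘ j 0)) ⟨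
  ℚ.toℚᵘ (ι i) ℚᵘ.* ℚ.toℚᵘ (ι j)  ≃⟨ ℚ.toℚᵘ-homo-* (ι i) (ι j) ⟨
  ℚ.toℚᵘ (ι i ℚ.* ι j)            ∎′)
  where open ℚᵘ.≤-Reasoning renaming (_∎ to _∎′)

ι-homo-^ : ∀ i n → ι (i ^ n) ≡ ι i ^ℚ n
ι-homo-^ i zero    = refl
ι-homo-^ i (suc n) = trans (ι-homo-* i (i ^ n)) (cong (ι i ℚ.*_) (ι-homo-^ i n))

1^n≡1 : ∀ n → 1ℚ ^ℚ n ≡ 1ℚ
1^n≡1 n = trans (sym (ι-homo-^ (+ 1) n)) (cong ι (ℤ.^-zeroˡ n))

-- Nonzeroness proofs are irrelevant, so matching on `refl` suffices even though the two reciprocals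
-- carry different ones.
1/-cong : ∀ {p q} .{{_ : ℚ.NonZero p}} .{{_ : ℚ.NonZero q}} → p ≡ q → 1/ p ≡ 1/ q
1/-cong refl = refl

-- The characteristic roots of the recurrence are 2 and 1; the coefficients of their powers are
-- fixed by the two initial values.
m≡2^n+1 : ∀ n → m n ≡ (+ 2) ^ n ℤ.+ + 1
m≡2^n+1 0             = refl
m≡2^n+1 1             = refl
m≡2^n+1 (suc (suc n)) = trans
  (cong₂ (λ a b → + 3 ℤ.* a - + 2 ℤ.* b) (m≡2^n+1 (suc n)) (m≡2^n+1 n))
  (lemma ((+ 2) ^ n))
  where
  lemma : ∀ a → + 3 ℤ.* (+ 2 ℤ.* a ℤ.+ + 1) - + 2 ℤ.* (a ℤ.+ + 1)
              ≡ + 2 ℤ.* (+ 2 ℤ.* a) ℤ.+ + 1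
  lemma = ℤ.solve-∀

binomialTerm : (ℕ → ℚ) → (n : ℕ) → Fin (suc n) → ℚ
binomialTerm f n i = (n C toℕ i) × f (toℕ i)

binomialTransform-cong : ∀ {f g} → f ≗ g → binomialTransform f ≗ binomialTransform g
binomialTransform-cong f≗g n = sum-cong-≗ {suc n} λ i → ×-congʳ (n C toℕ i) (f≗g (toℕ i))

binomialTransform-+ : ∀ f g n → binomialTransform (λ i → f i ℚ.+ g i) n
                              ≡ binomialTransform f n ℚ.+ binomialTransform g n
binomialTransform-+ f g n = trans
  (sum-cong-≗ {suc n} λ i → ×-distrib-+ (f (toℕ i)) (g (toℕ i)) (n C toℕ i))
  (∑-distrib-+ (binomialTerm f n) (binomialTerm g n))

-- Serves twice: to pull out the common factor 1 / M_k, and to pull out the sign - 1.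
binomialTransform-*ʳ : ∀ f c n → binomialTransform (λ i → f i ℚ.* c) n
                               ≡ binomialTransform f n ℚ.* c
binomialTransform-*ʳ f c n = sym (trans
  (*-distribʳ-sum c (binomialTerm f n))
  (sum-cong-≗ {suc n} λ i → ×-assoc-* (n C toℕ i) (f (toℕ i)) c))

-- The binomial theorem for a + 1, in which the factors 1^(n - i) drop out.
binomialTransform-^ : ∀ a n → binomialTransform (a ^ℚ_) n ≡ (a ℚ.+ 1ℚ) ^ℚ n
binomialTransform-^ a n = sym (trans
  (Binomial.theorem n a 1ℚ)
  (sum-cong-≗ {suc n} λ i → ×-congʳ (n C toℕ i) (trans
    (cong (a ^ℚ toℕ i ℚ.*_) (1^n≡1 (n ℕ.∸ toℕ i)))
    (ℚ.*-identityʳ (a ^ℚ toℕ i)))))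

-- The difference is written with a factor − 1 so that linearity applies to it.
M⁽k⁾-as-powers : ∀ k .{{_ : NonZero k}} i →
  M⁽ k ⁾ i ≡ (ι ((+ 2) ^ k) ^ℚ i ℚ.+ 1ℚ ^ℚ i ℚ.* ℚ.- 1ℚ) ℚ.* (1/ ι ((+ 2) ^ k - + 1)) {{ι[2^k-1]-nonZero k}}
M⁽k⁾-as-powers k i = cong₂ ℚ._*_
  (begin
    ι (M (k ℕ.* i))                              ≡⟨ cong ι (M≡2^n-1 (k ℕ.* i)) ⟩
    ι ((+ 2) ^ (k ℕ.* i) - + 1)                  ≡⟨ ι-homo-+ ((+ 2) ^ (k ℕ.* i)) (ℤ.- + 1) ⟩
    -- The constant - 1 evaluates from `1ℚ * - 1ℚ`, whose first factor is then replaced by a power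
    -- of 1.
    ι ((+ 2) ^ (k ℕ.* i)) ℚ.+ ℚ.- 1ℚ             ≡⟨ cong₂ ℚ._+_ power (cong (ℚ._* ℚ.- 1ℚ) (sym (1^n≡1 i))) ⟩
    ι ((+ 2) ^ k) ^ℚ i ℚ.+ 1ℚ ^ℚ i ℚ.* ℚ.- 1ℚ    ∎)
  (1/-cong {{ιM-nonZero k}} {{ι[2^k-1]-nonZero k}} (cong ι (M≡2^n-1 k)))
  where
  power : ι ((+ 2) ^ (k ℕ.* i)) ≡ ι ((+ 2) ^ k) ^ℚ i
  power = trans (cong ι (sym (ℤ.^-*-assoc (+ 2) k i))) (ι-homo-^ ((+ 2) ^ k) i)

b-closed : ∀ k .{{_ : NonZero k}} n →
  b k n ≡ (ι (m k) ^ℚ n ℚ.- ι (+ 2) ^ℚ n) ℚ.* (1/ ι ((+ 2) ^ k - + 1)) {{ι[2^k-1]-nonZero k}}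
b-closed k n = begin
  b k n
    ≡⟨ binomialTransform-cong (M⁽k⁾-as-powers k) n ⟩
  binomialTransform (λ i → (A ^ℚ i ℚ.+ 1ℚ ^ℚ i ℚ.* ℚ.- 1ℚ) ℚ.* c) n
    ≡⟨ binomialTransform-*ʳ (λ i → A ^ℚ i ℚ.+ 1ℚ ^ℚ i ℚ.* ℚ.- 1ℚ) c n ⟩
  binomialTransform (λ i → A ^ℚ i ℚ.+ 1ℚ ^ℚ i ℚ.* ℚ.- 1ℚ) n ℚ.* c
    ≡⟨ cong (ℚ._* c) (binomialTransform-+ (A ^ℚ_) (λ i → 1ℚ ^ℚ i ℚ.* ℚ.- 1ℚ) n) ⟩
  (binomialTransform (A ^ℚ_) n ℚ.+ binomialTransform (λ i → 1ℚ ^ℚ i ℚ.* ℚ.- 1ℚ) n) ℚ.* c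
    ≡⟨ cong (λ q → (binomialTransform (A ^ℚ_) n ℚ.+ q) ℚ.* c) (binomialTransform-*ʳ (1ℚ ^ℚ_) (ℚ.- 1ℚ) n) ⟩
  (binomialTransform (A ^ℚ_) n ℚ.+ binomialTransform (1ℚ ^ℚ_) n ℚ.* ℚ.- 1ℚ) ℚ.* c
    -- The powers of 1 transform to `(1ℚ + 1ℚ) ^ n`, and `1ℚ + 1ℚ` evaluates to `ι (+ 2)`; this is
    -- the source of e^{2x}.
    ≡⟨ cong₂ (λ p q → (p ℚ.+ q ℚ.* ℚ.- 1ℚ) ℚ.* c) (binomialTransform-^ A n) (binomialTransform-^ 1ℚ n) ⟩
  ((A ℚ.+ 1ℚ) ^ℚ n ℚ.+ ι (+ 2) ^ℚ n ℚ.* ℚ.- 1ℚ) ℚ.* c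
    ≡⟨ cong₂ (λ p q → (p ^ℚ n ℚ.+ q) ℚ.* c) A+1≡m (x*-1≡-x (ι (+ 2) ^ℚ n)) ⟩
  (ι (m k) ^ℚ n ℚ.- ι (+ 2) ^ℚ n) ℚ.* c
    ∎
  where
  A = ι ((+ 2) ^ k)
  c = (1/ ι ((+ 2) ^ k - + 1)) {{ι[2^k-1]-nonZero k}}

  A+1≡m : A ℚ.+ 1ℚ ≡ ι (m k)
  A+1≡m = sym (trans (cong ι (m≡2^n+1 k)) (ι-homo-+ ((+ 2) ^ k) (+ 1)))

  x*-1≡-x : ∀ x → x ℚ.* ℚ.- 1ℚ ≡ ℚ.- x
  x*-1≡-x x = trans (sym (ℚ.neg-distribʳ-* x 1ℚ)) (cong ℚ.-_ (ℚ.*-identityʳ x))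

theorem2p25 : (k : ℕ) .{{_ : NonZero k}} →
    E k ≗ ((e^[ ι (m k) x] ⊖ e^[ ι (+ 2) x]) ⊘ ι ((+ 2) ^ k - + 1)) {{ι[2^k-1]-nonZero k}}
theorem2p25 k n = trans
  (cong (ℚ._* _) (b-closed k n))
  -- Here `c` is the reciprocal of 2^k - 1 and `f` is 1 / n!; each `con 1ℚ` is the constant sequence
  -- whose generating function is `exp`.
  (solve 4 (λ p q c f → (p :- q) :* c :* f := (p :* (con 1ℚ :* f) :- q :* (con 1ℚ :* f)) :* c) refl
    (ι (m k) ^ℚ n) (ι (+ 2) ^ℚ n) _ _)
  where open +-*-Solver
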